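{- For all $*\in\{\square,\boxtimes,\circ\}$ (the Cartesian, strong, and lexicographic products), if $\mathcal{G}$ and $\mathcal{H}$ are graph classes with positive vertex expansion, then there exists a constant $c>0$ such that every graph $G*H\in\mathcal{G}*\mathcal{H}$ has a subgraph $S$ with $\operatorname{tw}(S)\geq c\,|V(G*H)|$, hence $|V(S)|\geq c\,|V(G*H)|-1$, and $\varphi(S)\geq c$.
   Context: All graphs are simple, finite and undirected. For a graph $G$ and $X\subseteq V(G)$, let $N_G(X)=\bigcup_{x\in X}N_G(x)\setminus X$. The vertex expansion of a graph $G$ is $$\varphi(G)=\min_{X\subseteq V(G)\,:\,0<|X|\leq \frac12|V(G)|}\frac{|N_G(X)|}{|X|}.$$ The vertex expansion of a graph class $\mathcal{G}$ is $\varphi(\mathcal{G})=\inf_{G\in\mathcal{G}}\varphi(G)$; the class has positive vertex expansion if $\varphi(\mathcal{G})>0$. For graph classes $\mathcal{G}$ and $\mathcal{H}$ and $*\in\{\square,\boxtimes,\circ\}$, define $\mathcal{G}*\mathcal{H}=\{G*H : G\in\mathcal{G}, H\in\mathcal{H}\}$. A tree-decomposition of a graph $G$ is a pair $(T,\beta)$ consisting of a tree $T$ and a function $\beta:V(T)\to 2^{V(G)}$ such that (i) for every $v\in V(G)$, the set $\{t\in V(T): v\in\beta(t)\}$ is non-empty and induces a connected subgraph of $T$; and (ii) for every edge $uv\in E(G)$ there is $t\in V(T)$ with $\{u,v\}\subseteq\beta(t)$. Its width is $\max_{t\in V(T)}|\beta(t)|-1$. The treewidth $\operatorname{tw}(G)$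 is the minimum width of a tree-decomposition of $G$. All three products of $G$ and $H$ have vertex set $V(G)\times V(H)$. In the Cartesian product $G\,\square\, H$, $(g_1,h_1)(g_2,h_2)$ is an edge iff $g_1=g_2$ and $h_1h_2\in E(H)$; or $g_1g_2\in E(G)$ and $h_1=h_2$. In the strong product $G\boxtimes H$, it is an edge iff it is an edge of $G\,\square\, H$, or $g_1g_2\in E(G)$ and $h_1h_2\in E(H)$. In the lexicographic product $G\circ H$, it is an edge iff $g_1g_2\in E(G)$; or $g_1=g_2$ and $h_1h_2\in E(H)$. -}

module Defs where

open import Data.Fin.Base using (Fin; zero; suc; inject₁; fromℕ; remQuot)
import Data.Fin.Properties as Fin
open import Data.Fin.Subset using (Subset; _∈_; ∣_∣)
open import Data.Fin.Subset.Properties using (_∈?_)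
open import Data.Integer.Base as ℤ using (ℤ; +_)
import Data.Integer.Properties as ℤ
open import Data.Nat.Base as ℕ using (ℕ; NonZero)
open import Data.Product.Base using (Σ; ∃; ∃-syntax; _×_; _,_)
open import Data.Rational.Base using (ℚ; _/_; _≤_; _<_; 0ℚ)
open import Data.Rational.Properties
  using (≤-trans; toℚᵘ-cancel-≤; toℚᵘ-fromℚᵘ)
import Data.Rational.Unnormalised.Base as ℚᵘ
import Data.Rational.Unnormalised.Properties as ℚᵘ
open import Data.Sum.Base using (_⊎_; inj₁; inj₂)
open import Data.Unit.Base using (⊤)
open import Data.Vec.Base using (tabulate)
import Data.Vec.Functional as Vector
open import Function.Base using (_on_)
open import Function.Bundles using (_⇔_; mk⇔)
open import Function.Definitions using (Injective)
open import Level using (Level; 0ℓ; _⊔_) renaming (suc to lsuc)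
open import Relation.Binary.Construct.Closure.ReflexiveTransitive using (Star)
import Relation.Binary.Construct.On as On
open import Relation.Binary.Core using (Rel)
open import Relation.Binary.Definitions using (Decidable; Irreflexive; Symmetric)
open import Relation.Binary.PropositionalEquality using (_≡_; refl; sym; cong)
open import Relation.Nullary using (¬_; does; ¬?; _×-dec_; _⊎-dec_)
open import Relation.Unary using (Pred)

record Graph : Set₁ where
  field
    order      : ℕ
    Adj        : Rel (Fin order) 0ℓ
    adj?       : Decidable Adj
    adj-sym    : Symmetric Adj
    adj-irrefl : Irreflexive _≡_ Adj

  V : Set
  V = Fin order

open Graph

GraphClass : (ℓ : Level) → Set (lsuc 0ℓ ⊔ lsuc ℓ)
GraphClass ℓ = Pred Graph ℓ

-- S is (up to isomorphism) a subgraph of G, not necessarily induced or spanning.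
record _⊑_ (S G : Graph) : Set where
  field
    embed     : V S → V G
    injective : Injective _≡_ _≡_ embed
    preserves : ∀ {u v} → Adj S u v → Adj G (embed u) (embed v)

N[_] : (G : Graph) → Subset (order G) → Subset (order G)
N[ G ] X = tabulate λ v →
  does (¬? (v ∈? X) ×-dec Fin.any? λ x → (x ∈? X) ×-dec adj? G x v)

expansionRatio : (G : Graph) (X : Subset (order G)) .{{_ : NonZero ∣ X ∣}} → ℚ
expansionRatio G X = + ∣ N[ G ] X ∣ / ∣ X ∣

-- q is the minimum defining φ(G).  No set X is admissible when G has fewer
-- than two vertices; φ(G) is then undefined.
record IsVertexExpansion (G : Graph) (q : ℚ) : Set where
  field
    attained : ∃[ X ] Σ (NonZero ∣ X ∣) λ nz →
               2 ℕ.* ∣ X ∣ ℕ.≤ order G × expansionRatio G X {{nz}} ≡ q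
    minimal  : ∀ X .{{_ : NonZero ∣ X ∣}} →
               2 ℕ.* ∣ X ∣ ℕ.≤ order G → q ≤ expansionRatio G X

φ[_]≥_ : Graph → ℚ → Set
φ[ G ]≥ c = ∃[ q ] IsVertexExpansion G q × c ≤ q

-- The infimum of φ over 𝒢 is a real number; it is positive exactly when some
-- positive rational is a lower bound.
PositiveVertexExpansion : ∀ {ℓ} → GraphClass ℓ → Set (lsuc 0ℓ ⊔ ℓ)
PositiveVertexExpansion 𝒢 = ∃[ ε ] 0ℚ < ε × (∀ G → 𝒢 G → φ[ G ]≥ ε)

record InducesConnected (G : Graph) (U : Pred (V G) 0ℓ) : Set where
  field
    nonempty  : ∃ U
    connected : ∀ {u v} → U u → U v →
                Star (λ a b → Adj G a b × U a × U b) u v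

Connected : Graph → Set
Connected G = InducesConnected G (λ _ → ⊤)

-- A cycle of length 3 + k.
record Cycle (G : Graph) : Set where
  field
    {k}      : ℕ
    vertex   : Fin (3 ℕ.+ k) → V G
    distinct : Injective _≡_ _≡_ vertex
    step     : ∀ (i : Fin (2 ℕ.+ k)) → Adj G (vertex (inject₁ i)) (vertex (suc i))
    closing  : Adj G (vertex (fromℕ (2 ℕ.+ k))) (vertex zero)

record IsTree (T : Graph) : Set where
  field
    connected : Connected T
    acyclic   : ¬ Cycle T

record TreeDecomposition (G : Graph) : Set₁ where
  field
    T             : Graph
    isTree        : IsTree T
    β             : V T → Subset (order G)
    vertexSubtree : ∀ v → InducesConnected T (λ t → v ∈ β t)
    edgeCovered   : ∀ {u v} → Adj G u v → ∃[ t ] u ∈ β t × v ∈ β t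

  width : ℤ
  width = Vector.foldr ℕ._⊔_ 0 (λ t → ∣ β t ∣) ℤ.⊖ 1

open TreeDecomposition using (width)

record IsTreewidth (G : Graph) (w : ℤ) : Set₁ where
  field
    attained : ∃[ D ] width {G} D ≡ w
    minimal  : ∀ (D : TreeDecomposition G) → w ℤ.≤ width D

-- A lower bound on a minimum, stated without first exhibiting a minimiser:
-- decompositions of G are infinite in number.  See tw≥⇔≤.
tw[_]≥_ : Graph → ℚ → Set₁
tw[ G ]≥ r = ∀ (D : TreeDecomposition G) → r ≤ width D / 1

/1-mono-≤ : ∀ {i j : ℤ} → i ℤ.≤ j → i / 1 ≤ j / 1
/1-mono-≤ {i} {j} i≤j = toℚᵘ-cancel-≤
  (ℚᵘ.≤-trans (ℚᵘ.≤-reflexive (toℚᵘ-fromℚᵘ (ℚᵘ.mkℚᵘ i 0)))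
  (ℚᵘ.≤-trans (ℚᵘ.*≤* (ℤ.*-monoʳ-≤-nonNeg (+ 1) i≤j))
              (ℚᵘ.≤-reflexive (ℚᵘ.≃-sym (toℚᵘ-fromℚᵘ (ℚᵘ.mkℚᵘ j 0))))))

tw≥⇔≤ : ∀ {G w r} → IsTreewidth G w → (tw[ G ]≥ r) ⇔ (r ≤ w / 1)
tw≥⇔≤ record { attained = D , refl ; minimal = min } =
  mk⇔ (λ lower → lower D) (λ r≤w D′ → ≤-trans r≤w (/1-mono-≤ (min D′)))

-- remQuot identifies Fin (m * n) with Fin m × Fin n.
onPairs : ∀ {m n} (R : Rel (Fin m × Fin n) 0ℓ) →
          Decidable R → Symmetric R → Irreflexive _≡_ R → Graph
onPairs {m} {n} R R? R-sym R-irrefl = record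
  { order      = m ℕ.* n
  ; Adj        = R on remQuot n
  ; adj?       = On.decidable (remQuot n) R R?
  ; adj-sym    = On.symmetric (remQuot n) R R-sym
  ; adj-irrefl = λ i≡j → R-irrefl (cong (remQuot n) i≡j)
  }

module _ (G H : Graph) where

  CartesianAdj StrongAdj LexicographicAdj : Rel (V G × V H) 0ℓ
  CartesianAdj (g₁ , h₁) (g₂ , h₂) =
    (g₁ ≡ g₂ × Adj H h₁ h₂) ⊎ (Adj G g₁ g₂ × h₁ ≡ h₂)
  StrongAdj (g₁ , h₁) (g₂ , h₂) =
    CartesianAdj (g₁ , h₁) (g₂ , h₂) ⊎ (Adj G g₁ g₂ × Adj H h₁ h₂)
  LexicographicAdj (g₁ , h₁) (g₂ , h₂) =
    Adj G g₁ g₂ ⊎ (g₁ ≡ g₂ × Adj H h₁ h₂)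

  private
    cart? : Decidable CartesianAdj
    cart? (g₁ , h₁) (g₂ , h₂) =
      ((g₁ Fin.≟ g₂) ×-dec adj? H h₁ h₂) ⊎-dec (adj? G g₁ g₂ ×-dec (h₁ Fin.≟ h₂))

    cart-sym : Symmetric CartesianAdj
    cart-sym (inj₁ (p , e)) = inj₁ (sym p , adj-sym H e)
    cart-sym (inj₂ (e , p)) = inj₂ (adj-sym G e , sym p)

    cart-irrefl : Irreflexive _≡_ CartesianAdj
    cart-irrefl refl (inj₁ (_ , e)) = adj-irrefl H refl e
    cart-irrefl refl (inj₂ (e , _)) = adj-irrefl G refl e

    strong? : Decidable StrongAdj
    strong? p@(g₁ , h₁) q@(g₂ , h₂) =
      cart? p q ⊎-dec (adj? G g₁ g₂ ×-dec adj? H h₁ h₂)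

    strong-sym : Symmetric StrongAdj
    strong-sym (inj₁ e)       = inj₁ (cart-sym e)
    strong-sym (inj₂ (e , f)) = inj₂ (adj-sym G e , adj-sym H f)

    strong-irrefl : Irreflexive _≡_ StrongAdj
    strong-irrefl p≡q  (inj₁ e)       = cart-irrefl p≡q e
    strong-irrefl refl (inj₂ (e , _)) = adj-irrefl G refl e

    lex? : Decidable LexicographicAdj
    lex? (g₁ , h₁) (g₂ , h₂) =
      adj? G g₁ g₂ ⊎-dec ((g₁ Fin.≟ g₂) ×-dec adj? H h₁ h₂)

    lex-sym : Symmetric LexicographicAdj
    lex-sym (inj₁ e)       = inj₁ (adj-sym G e)
    lex-sym (inj₂ (p , e)) = inj₂ (sym p , adj-sym H e)

    lex-irrefl : Irreflexive _≡_ LexicographicAdj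
    lex-irrefl refl (inj₁ e)       = adj-irrefl G refl e
    lex-irrefl refl (inj₂ (_ , e)) = adj-irrefl H refl e

  _□_ _⊠_ _⊚_ : Graph
  _□_ = onPairs CartesianAdj cart? cart-sym cart-irrefl
  _⊠_ = onPairs StrongAdj strong? strong-sym strong-irrefl
  _⊚_ = onPairs LexicographicAdj lex? lex-sym lex-irrefl

data Product : Set where
  cartesian strong lexicographic : Product

_⟨_⟩_ : Graph → Product → Graph → Graph
G ⟨ cartesian ⟩     H = G □ H
G ⟨ strong ⟩        H = G ⊠ H
G ⟨ lexicographic ⟩ H = G ⊚ H

ProductClass : ∀ {ℓ₁ ℓ₂} → Product → GraphClass ℓ₁ → GraphClass ℓ₂ →
               GraphClass (lsuc 0ℓ ⊔ ℓ₁ ⊔ ℓ₂)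
ProductClass ∗ 𝒢 ℋ P = ∃[ G ] ∃[ H ] 𝒢 G × ℋ H × P ≡ G ⟨ ∗ ⟩ H

infix 4 _⊑_
infix 4 φ[_]≥_ tw[_]≥_

∣V_∣ : Graph → ℚ
∣V G ∣ = + order G / 1

-- The subgraph can be taken to be the product P itself.  By expansion of the factors, the total
-- deviation of the rows of X ⊆ V(P), and likewise of its columns, from being full or empty is
-- O(|N(X)|).  So X differs by O(|N(X)|) from a union of rows, all of whose columns are equal and
-- hence nearly full or nearly empty; if |X| ≤ |P|/2, this forces |X| = O(|N(X)|).  Thus P expands.
-- For the treewidth, every tree-decomposition has a bag such that each remaining component has at
-- most half of the vertices.  Unless that bag is large, some union of these components has between
-- a quarter and a half of the vertices; its neighbourhood lies in the bag, which is therefore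
-- large by expansion.

module Submission where

import Algebra.Properties.Semiring.Sum
open import Data.Bool.Base using (Bool; true; false; not; _xor_)
open import Data.Bool.Properties using (xor-comm; xor-identityʳ)
open import Data.Fin.Base
  using (Fin; zero; suc; inject₁; fromℕ; fromℕ<; combine; remQuot; _↑ˡ_; _↑ʳ_)
import Data.Fin.Properties as Fin
open import Data.Fin.Subset
  using (Subset; inside; outside; ∣_∣; ⁅_⁆; ⊥; _∈_; _∉_; ∁; _∪_; _⊆_; _⊂_)
open import Data.Fin.Subset.Properties
import Data.Integer.Properties as ℤ
open import Data.List.Base as List using (List)
import Data.List.Extrema
open import Data.List.Membership.Propositional using () renaming (_∈_ to _∈ₗ_)
open import Data.List.Membership.Propositional.Properties
  using (∈-++⁺ˡ; ∈-++⁺ʳ; ∈-map⁺; ∈-filter⁺)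
import Data.List.Relation.Unary.All as All
open import Data.List.Relation.Unary.All.Properties using (all-filter)
open import Data.List.Relation.Unary.Any using (here)
open import Data.Nat.Base as ℕ using (zero; suc; NonZero; s≤s; z≤n)
open import Data.Nat.Induction using (<-wellFounded)
import Data.Nat.Properties as ℕ
open import Data.Nat.Tactic.RingSolver using (solve-∀)
open import Data.Product.Base as Product
  using (∃; ∃-syntax; Σ; _×_; _,_; proj₁; proj₂)
import Data.Rational.Properties as ℚ
import Data.Rational.Unnormalised.Base as ℚᵘ
import Data.Rational.Unnormalised.Properties as ℚᵘ
open import Data.Sum.Base as Sum using (_⊎_; inj₁; inj₂)
open import Data.Vec.Base using ([]; _∷_; tabulate; lookup)
import Data.Vec.Functional as Vector
open import Data.Vec.Properties using (lookup∘tabulate; tabulate∘lookup; lookup⇒[]=; []=⇒lookup)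
open import Effect.Monad using (RawMonad)
open import Function.Base using (_∘_; _on_; id)
open import Function.Definitions using (Injective)
open import Induction.WellFounded using (Acc; acc)
open import Level using (0ℓ)
open import Relation.Binary.Bundles using (DecTotalOrder)
open import Relation.Binary.Core using (Rel; _⇒_)
import Relation.Binary.Definitions as B
open import Relation.Binary.PropositionalEquality
open import Relation.Nullary using (¬_; Dec; yes; no; does; contradiction; _×-dec_; ¬?)
open import Relation.Nullary.Decidable using (dec-true; decidable-stable; ¬¬-excluded-middle)
open import Relation.Nullary.Negation using (¬¬-Monad)
open import Relation.Unary using (Decidable)

open import Defs

open Graph

-- Vertex expansion over the natural numbers.

module Expansion where

  open import Data.Nat.Base using (ℕ; _+_; _*_; _⊓_; _≤_)
  open import Data.Nat.Properties

  open Algebra.Properties.Semiring.Sum +-*-semiring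
    using (sum; ∑-distrib-+; ∑-comm; *-distribʳ-sum; *-distribˡ-sum; sum-cong-≗; sum-syntax)

  module _ {n} {P : Fin n → Set} (P? : Decidable P) where

    subset : Subset n
    subset = tabulate (does ∘ P?)

    ∈-subset⁺ : ∀ {v} → P v → v ∈ subset
    ∈-subset⁺ {v} p = lookup⇒[]= v subset (trans (lookup∘tabulate _ v) (dec-true (P? v) p))

    ∈-subset⁻ : ∀ {v} → v ∈ subset → P v
    ∈-subset⁻ {v} v∈ with P? v | trans (sym (lookup∘tabulate (does ∘ P?) v)) ([]=⇒lookup v∈)
    ... | yes p | _ = p

  module _ (G : Graph) (X : Subset (order G)) where

    private
      boundary? : Decidable λ v → v ∉ X × ∃[ x ] x ∈ X × Adj G x v
      boundary? v = ¬? (v ∈? X) ×-dec Fin.any? λ x → (x ∈? X) ×-dec adj? G x v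

    ∈-N⁺ : ∀ {v x} → v ∉ X → x ∈ X → Adj G x v → v ∈ N[ G ] X
    ∈-N⁺ v∉X x∈X x~v = ∈-subset⁺ boundary? (v∉X , _ , x∈X , x~v)

    ∈-N⁻ : ∀ {v} → v ∈ N[ G ] X → v ∉ X × ∃[ x ] x ∈ X × Adj G x v
    ∈-N⁻ = ∈-subset⁻ boundary?

  ∣p∣+∣∁p∣≡n : ∀ {n} (p : Subset n) → ∣ p ∣ + ∣ ∁ p ∣ ≡ n
  ∣p∣+∣∁p∣≡n p = trans (cong (∣ p ∣ +_) (∣∁p∣≡n∸∣p∣ p)) (m+[n∸m]≡n (∣p∣≤n p))

  ∣p∪q∣≤∣p∣+∣q∣ : ∀ {n} (p q : Subset n) → ∣ p ∪ q ∣ ≤ ∣ p ∣ + ∣ q ∣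
  ∣p∪q∣≤∣p∣+∣q∣ []            []            = z≤n
  ∣p∪q∣≤∣p∣+∣q∣ (inside ∷ p)  (inside ∷ q)  =
    s≤s (≤-trans (∣p∪q∣≤∣p∣+∣q∣ p q) (+-monoʳ-≤ ∣ p ∣ (n≤1+n ∣ q ∣)))
  ∣p∪q∣≤∣p∣+∣q∣ (inside ∷ p)  (outside ∷ q) = s≤s (∣p∪q∣≤∣p∣+∣q∣ p q)
  ∣p∪q∣≤∣p∣+∣q∣ (outside ∷ p) (inside ∷ q)  =
    ≤-trans (s≤s (∣p∪q∣≤∣p∣+∣q∣ p q)) (≤-reflexive (sym (+-suc ∣ p ∣ ∣ q ∣)))
  ∣p∪q∣≤∣p∣+∣q∣ (outside ∷ p) (outside ∷ q) = ∣p∪q∣≤∣p∣+∣q∣ p q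

  -- The inequality `φ(G) ≥ 1/K` with denominators cleared; the empty set satisfies it trivially.
  Expands : ℕ → Graph → Set
  Expands K G = ∀ X → 2 * ∣ X ∣ ≤ order G → ∣ X ∣ ≤ K * ∣ N[ G ] X ∣

  expands-mono : ∀ {K L} G → K ≤ L → Expands K G → Expands L G
  expands-mono G K≤L exp X small = ≤-trans (exp X small) (*-monoˡ-≤ ∣ N[ G ] X ∣ K≤L)

  -- A large set is handled by applying the expansion to Y = ∁ (X ∪ N X), whose neighbours all lie
  -- in N X.
  twoSided : ∀ {K} G → Expands K G → ∀ X → ∣ X ∣ ⊓ ∣ ∁ X ∣ ≤ suc K * ∣ N[ G ] X ∣
  twoSided {K} G exp X with 2 * ∣ X ∣ ≤? order G
  ... | yes small = ≤-trans (m⊓n≤m ∣ X ∣ ∣ ∁ X ∣)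
    (≤-trans (exp X small) (*-monoˡ-≤ ∣ N[ G ] X ∣ (n≤1+n K)))
  ... | no  large = ≤-trans (m⊓n≤n ∣ X ∣ ∣ ∁ X ∣) (begin
    ∣ ∁ X ∣                              ≤⟨ p⊆q⇒∣p∣≤∣q∣ ∁X⊆N∪Y ⟩
    ∣ N[ G ] X ∪ Y ∣                     ≤⟨ ∣p∪q∣≤∣p∣+∣q∣ (N[ G ] X) Y ⟩
    ∣ N[ G ] X ∣ + ∣ Y ∣                 ≤⟨ +-monoʳ-≤ ∣ N[ G ] X ∣ (exp Y 2∣Y∣≤n) ⟩
    ∣ N[ G ] X ∣ + K * ∣ N[ G ] Y ∣      ≤⟨ +-monoʳ-≤ ∣ N[ G ] X ∣ (*-monoʳ-≤ K (p⊆q⇒∣p∣≤∣q∣ NY⊆NX)) ⟩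
    ∣ N[ G ] X ∣ + K * ∣ N[ G ] X ∣      ∎)
    where
    open ≤-Reasoning
    Y = ∁ (X ∪ N[ G ] X)

    ∁X⊆N∪Y : ∁ X ⊆ N[ G ] X ∪ Y
    ∁X⊆N∪Y {v} v∈∁X with v ∈? N[ G ] X
    ... | yes v∈N = x∈p∪q⁺ (inj₁ v∈N)
    ... | no  v∉N = x∈p∪q⁺ (inj₂ (x∉p⇒x∈∁p λ v∈X∪N → case (x∈p∪q⁻ X (N[ G ] X) v∈X∪N)))
      where
      case : v ∈ X ⊎ v ∈ N[ G ] X → _
      case (inj₁ v∈X) = x∈∁p⇒x∉p v∈∁X v∈X
      case (inj₂ v∈N) = v∉N v∈N

    Y⊆∁X : Y ⊆ ∁ X
    Y⊆∁X = p⊆q⇒∁p⊇∁q (p⊆p∪q (N[ G ] X))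

    NY⊆NX : N[ G ] Y ⊆ N[ G ] X
    NY⊆NX {v} v∈NY with v∉Y , y , y∈Y , y~v ← ∈-N⁻ G Y v∈NY
      with x∈p∪q⁻ X (N[ G ] X) (x∉∁p⇒x∈p v∉Y)
    ... | inj₂ v∈NX = v∈NX
    ... | inj₁ v∈X  = contradiction
      (q⊆p∪q X (N[ G ] X) (∈-N⁺ G X (x∈∁p⇒x∉p (Y⊆∁X y∈Y)) v∈X (adj-sym G y~v))) (x∈∁p⇒x∉p y∈Y)

    2∣Y∣≤n : 2 * ∣ Y ∣ ≤ order G
    2∣Y∣≤n = +-cancelˡ-≤ (order G) _ _ (begin
      order G + 2 * ∣ Y ∣         ≤⟨ +-mono-≤ (<⇒≤ (≰⇒> large)) (*-monoʳ-≤ 2 (p⊆q⇒∣p∣≤∣q∣ Y⊆∁X)) ⟩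
      2 * ∣ X ∣ + 2 * ∣ ∁ X ∣     ≡⟨ *-distribˡ-+ 2 ∣ X ∣ ∣ ∁ X ∣ ⟨
      2 * (∣ X ∣ + ∣ ∁ X ∣)       ≡⟨ cong (2 *_) (∣p∣+∣∁p∣≡n X) ⟩
      2 * order G                 ≡⟨ cong (order G +_) (+-identityʳ (order G)) ⟩
      order G + order G           ∎)

  -- Finite sums and counting.

  sum-mono-≤ : ∀ {n} {f g : Fin n → ℕ} → (∀ i → f i ≤ g i) → sum f ≤ sum g
  sum-mono-≤ {zero}  f≤g = z≤n
  sum-mono-≤ {suc n} f≤g = +-mono-≤ (f≤g zero) (sum-mono-≤ (f≤g ∘ suc))

  sum-const : ∀ n x → ∑[ _ < n ] x ≡ n * x
  sum-const zero    x = refl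
  sum-const (suc n) x = cong (x +_) (sum-const n x)

  𝟙 : Bool → ℕ
  𝟙 false = 0
  𝟙 true  = 1

  # : ∀ {n} → (Fin n → Bool) → ℕ
  # f = sum (𝟙 ∘ f)

  ∣tabulate∣≡# : ∀ {n} (f : Fin n → Bool) → ∣ tabulate f ∣ ≡ # f
  ∣tabulate∣≡# {zero}  f = refl
  ∣tabulate∣≡# {suc n} f with f zero
  ... | true  = cong suc (∣tabulate∣≡# (f ∘ suc))
  ... | false = ∣tabulate∣≡# (f ∘ suc)

  ∣∁tabulate∣≡# : ∀ {n} (f : Fin n → Bool) → ∣ ∁ (tabulate f) ∣ ≡ # (not ∘ f)
  ∣∁tabulate∣≡# {zero}  f = refl
  ∣∁tabulate∣≡# {suc n} f with f zero
  ... | true  = ∣∁tabulate∣≡# (f ∘ suc)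
  ... | false = cong suc (∣∁tabulate∣≡# (f ∘ suc))

  #+#not≡n : ∀ {n} (f : Fin n → Bool) → # f + # (not ∘ f) ≡ n
  #+#not≡n f = trans (cong₂ _+_ (sym (∣tabulate∣≡# f)) (sym (∣∁tabulate∣≡# f))) (∣p∣+∣∁p∣≡n (tabulate f))

  sum-splitAt : ∀ m {n} (f : Fin (m + n) → ℕ) →
                sum f ≡ ∑[ i < m ] f (i ↑ˡ n) + ∑[ j < n ] f (m ↑ʳ j)
  sum-splitAt zero    f = refl
  sum-splitAt (suc m) f =
    trans (cong (f zero +_) (sum-splitAt m (f ∘ suc))) (sym (+-assoc (f zero) _ _))

  sum-combine : ∀ m {n} (f : Fin (m * n) → ℕ) → sum f ≡ ∑[ i < m ] ∑[ j < n ] f (combine i j)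
  sum-combine zero        f = refl
  sum-combine (suc m) {n} f =
    trans (sum-splitAt n f) (cong (∑[ j < n ] f (j ↑ˡ (m * n)) +_) (sum-combine m (f ∘ (n ↑ʳ_))))

  -- Zero-one matrices with nearly constant rows and columns.

  module Majority {m n : ℕ} (χ : Fin m → Fin n → Bool)
    (majority? : ∀ i → Dec (# (not ∘ χ i) ≤ # (χ i))) where

    private
      open ≤-Reasoning

      row row′ : Fin m → ℕ
      row  i = # (χ i)
      row′ i = # (not ∘ χ i)

      col col′ : Fin n → ℕ
      col  j = # λ i → χ i j
      col′ j = # λ i → not (χ i j)

      major : Fin m → Bool
      major i = does (majority? i)

      -- Round every row to its majority value: `R` rows become all ones and `R′` all zeros. `A` and
      -- `B` count the entries to change so that every row, respectively every column, is constant.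
      R R′ A B x : ℕ
      R  = # major
      R′ = # (not ∘ major)
      A  = ∑[ i < m ] (row i ⊓ row′ i)
      B  = ∑[ j < n ] (col j ⊓ col′ j)
      x  = ∑[ i < m ] row i

      error : Fin m → Fin n → ℕ
      error i j = 𝟙 (χ i j xor major i)

      -- The entries of a row that rounding changes are exactly its minority.
      errors-row : ∀ i → ∑[ j < n ] error i j ≤ row i ⊓ row′ i
      errors-row i with majority? i
      ... | yes row′≤row = begin
        ∑[ j < n ] 𝟙 (χ i j xor true)  ≡⟨ sum-cong-≗ (λ j → cong 𝟙 (xor-comm (χ i j) true)) ⟩
        row′ i                         ≡⟨ m≥n⇒m⊓n≡n row′≤row ⟨
        row i ⊓ row′ i                 ∎
      ... | no  row′≰row = begin
        ∑[ j < n ] 𝟙 (χ i j xor false) ≡⟨ sum-cong-≗ (λ j → cong 𝟙 (xor-identityʳ (χ i j))) ⟩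
        row i                          ≡⟨ m≤n⇒m⊓n≡m (≰⇒≥ row′≰row) ⟨
        row i ⊓ row′ i                 ∎

      row≤ : ∀ i → row i ≤ 𝟙 (major i) * n + row i ⊓ row′ i
      row≤ i with majority? i
      ... | no  row′≰row = ≤-reflexive (sym (m≤n⇒m⊓n≡m (≰⇒≥ row′≰row)))
      ... | yes _        = begin
        row i                    ≤⟨ m≤m+n (row i) (row′ i) ⟩
        row i + row′ i           ≡⟨ #+#not≡n (χ i) ⟩
        n                        ≡⟨ *-identityˡ n ⟨
        1 * n                    ≤⟨ m≤m+n (1 * n) _ ⟩
        1 * n + row i ⊓ row′ i   ∎

      ≤row : ∀ i → 𝟙 (major i) * n ≤ row i + row i ⊓ row′ i
      ≤row i with majority? i
      ... | no  _        = z≤n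
      ... | yes row′≤row = begin
        1 * n                    ≡⟨ *-identityˡ n ⟩
        n                        ≡⟨ #+#not≡n (χ i) ⟨
        row i + row′ i           ≡⟨ cong (row i +_) (m≥n⇒m⊓n≡n row′≤row) ⟨
        row i + row i ⊓ row′ i   ∎

      x≤Rn+A : x ≤ R * n + A
      x≤Rn+A = begin
        x                                                  ≤⟨ sum-mono-≤ row≤ ⟩
        ∑[ i < m ] (𝟙 (major i) * n + row i ⊓ row′ i)      ≡⟨ ∑-distrib-+ (λ i → 𝟙 (major i) * n) _ ⟩
        ∑[ i < m ] (𝟙 (major i) * n) + A                   ≡⟨ cong (_+ A) (*-distribʳ-sum n (𝟙 ∘ major)) ⟨
        R * n + A                                          ∎

      Rn≤x+A : R * n ≤ x + A
      Rn≤x+A = begin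
        R * n                                      ≡⟨ *-distribʳ-sum n (𝟙 ∘ major) ⟩
        ∑[ i < m ] (𝟙 (major i) * n)               ≤⟨ sum-mono-≤ ≤row ⟩
        ∑[ i < m ] (row i + row i ⊓ row′ i)        ≡⟨ ∑-distrib-+ row _ ⟩
        x + A                                      ∎

      𝟙≤𝟙+xor : ∀ b c → 𝟙 c ≤ 𝟙 b + 𝟙 (b xor c)
      𝟙≤𝟙+xor b     false = z≤n
      𝟙≤𝟙+xor false true  = s≤s z≤n
      𝟙≤𝟙+xor true  true  = s≤s z≤n

      𝟙≤𝟙+xor′ : ∀ b c → 𝟙 (not c) ≤ 𝟙 (not b) + 𝟙 (b xor c)
      𝟙≤𝟙+xor′ b     true  = z≤n
      𝟙≤𝟙+xor′ false false = s≤s z≤n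
      𝟙≤𝟙+xor′ true  false = s≤s z≤n

      -- Every column of the rounded matrix is `major`, which is `R ⊓ R′` changes away from being
      -- constant. Each entry where column `j` differs from `major` affects this number by at most
      -- one.
      R⊓R′≤ : ∀ j → R ⊓ R′ ≤ col j ⊓ col′ j + ∑[ i < m ] error i j
      R⊓R′≤ j = begin
        R ⊓ R′                               ≤⟨ ⊓-mono-≤
          (≤-trans (sum-mono-≤ λ i → 𝟙≤𝟙+xor (χ i j) (major i))
            (≤-reflexive (∑-distrib-+ (λ i → 𝟙 (χ i j)) _)))
          (≤-trans (sum-mono-≤ λ i → 𝟙≤𝟙+xor′ (χ i j) (major i))
            (≤-reflexive (∑-distrib-+ (λ i → 𝟙 (not (χ i j))) _))) ⟩
        (col j + E) ⊓ (col′ j + E)           ≡⟨ +-distribʳ-⊓ E (col j) (col′ j) ⟨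
        col j ⊓ col′ j + E                   ∎
        where E = ∑[ i < m ] error i j

      -- The rounding errors arise column by column but are bounded row by row, so the two sums are
      -- exchanged.
      n[R⊓R′]≤B+A : n * (R ⊓ R′) ≤ B + A
      n[R⊓R′]≤B+A = begin
        n * (R ⊓ R′)                                             ≡⟨ sum-const n (R ⊓ R′) ⟨
        ∑[ _ < n ] (R ⊓ R′)                                      ≤⟨ sum-mono-≤ R⊓R′≤ ⟩
        ∑[ j < n ] (col j ⊓ col′ j + ∑[ i < m ] error i j)       ≡⟨ ∑-distrib-+ (λ j → col j ⊓ col′ j) _ ⟩
        B + ∑[ j < n ] ∑[ i < m ] error i j                      ≡⟨ cong (B +_) (∑-comm error) ⟨
        B + ∑[ i < m ] ∑[ j < n ] error i j                      ≤⟨ +-monoʳ-≤ B (sum-mono-≤ errors-row) ⟩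
        B + A                                                    ∎

    -- If zero rows prevail after rounding, `R * n` is at most `A + B`, and `x` exceeds it by at
    -- most `A`. Otherwise `R′ * n` is at most `A + B`, so `m * n` is at most `x` plus three
    -- deviations, and `2 * x ≤ m * n` lets one `x` be cancelled.
    total≤3D : ∀ {D} → A ≤ D → B ≤ D → 2 * x ≤ m * n → x ≤ 3 * D
    total≤3D {D} A≤D B≤D 2x≤mn with ≤-total R R′
    ... | inj₁ R≤R′ = begin
      x                   ≤⟨ x≤Rn+A ⟩
      R * n + A           ≡⟨ cong (_+ A) (trans (*-comm R n) (cong (n *_) (sym (m≤n⇒m⊓n≡m R≤R′)))) ⟩
      n * (R ⊓ R′) + A    ≤⟨ +-monoˡ-≤ A n[R⊓R′]≤B+A ⟩
      B + A + A           ≤⟨ +-mono-≤ (+-mono-≤ B≤D A≤D) A≤D ⟩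
      D + D + D           ≡⟨ triple D ⟩
      3 * D               ∎
      where
      triple : ∀ D → D + D + D ≡ 3 * D
      triple = solve-∀
    ... | inj₂ R′≤R = +-cancelˡ-≤ x _ _ (begin
      x + x                       ≡⟨ cong (x +_) (+-identityʳ x) ⟨
      2 * x                       ≤⟨ 2x≤mn ⟩
      m * n                       ≡⟨ cong (_* n) (#+#not≡n major) ⟨
      (R + R′) * n                ≡⟨ *-distribʳ-+ n R R′ ⟩
      R * n + R′ * n              ≡⟨ cong (R * n +_)
        (trans (*-comm R′ n) (cong (n *_) (sym (m≥n⇒m⊓n≡n R′≤R)))) ⟩
      R * n + n * (R ⊓ R′)        ≤⟨ +-mono-≤ Rn≤x+A n[R⊓R′]≤B+A ⟩
      x + A + (B + A)             ≤⟨ +-mono-≤ (+-monoʳ-≤ x A≤D) (+-mono-≤ B≤D A≤D) ⟩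
      x + D + (D + D)             ≡⟨ regroup x D ⟩
      x + 3 * D                   ∎)
      where
      regroup : ∀ x D → x + D + (D + D) ≡ x + 3 * D
      regroup = solve-∀

  -- Rows and columns of a vertex set of a product.

  module Fibres (m n : ℕ) (X : Subset (m * n)) where

    χ : Fin m → Fin n → Bool
    χ i j = lookup X (combine i j)

    row : Fin m → Subset n
    row i = tabulate (χ i)

    col : Fin n → Subset m
    col j = tabulate λ i → χ i j

    ∣X∣≡∑# : ∣ X ∣ ≡ ∑[ i < m ] # (χ i)
    ∣X∣≡∑# = trans (cong ∣_∣ (sym (tabulate∘lookup X)))
      (trans (∣tabulate∣≡# (lookup X)) (sum-combine m (𝟙 ∘ lookup X)))

    ∣X∣≡∑∣row∣ : ∣ X ∣ ≡ ∑[ i < m ] ∣ row i ∣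
    ∣X∣≡∑∣row∣ = trans ∣X∣≡∑# (sum-cong-≗ λ i → sym (∣tabulate∣≡# (χ i)))

    ∣X∣≡∑∣col∣ : ∣ X ∣ ≡ ∑[ j < n ] ∣ col j ∣
    ∣X∣≡∑∣col∣ = trans (trans ∣X∣≡∑# (∑-comm λ i j → 𝟙 (χ i j)))
      (sum-cong-≗ λ j → sym (∣tabulate∣≡# λ i → χ i j))

    ∈-row : ∀ {i j} → combine i j ∈ X → j ∈ row i
    ∈-row {i} {j} v∈ = lookup⇒[]= j (row i) (trans (lookup∘tabulate _ j) ([]=⇒lookup v∈))

    ∈-row⁻ : ∀ {i j} → j ∈ row i → combine i j ∈ X
    ∈-row⁻ {i} {j} v∈ = lookup⇒[]= _ X (trans (sym (lookup∘tabulate _ j)) ([]=⇒lookup v∈))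

    ∈-col : ∀ {i j} → combine i j ∈ X → i ∈ col j
    ∈-col {i} {j} v∈ = lookup⇒[]= i (col j) (trans (lookup∘tabulate _ i) ([]=⇒lookup v∈))

    ∈-col⁻ : ∀ {i j} → i ∈ col j → combine i j ∈ X
    ∈-col⁻ {i} {j} v∈ = lookup⇒[]= _ X (trans (sym (lookup∘tabulate _ i)) ([]=⇒lookup v∈))

  module _ (G H : Graph) (R : Rel (V G × V H) 0ℓ)
           (R? : B.Decidable (R on remQuot (order H)))
           (R-sym : B.Symmetric (R on remQuot (order H)))
           (R-irrefl : B.Irreflexive _≡_ (R on remQuot (order H)))
           (□⇒R : CartesianAdj G H ⇒ R) where

    private
      P : Graph
      P = record { adj? = R? ; adj-sym = R-sym ; adj-irrefl = R-irrefl }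

    adj-row : ∀ {g h h′} → Adj H h h′ → Adj P (combine g h) (combine g h′)
    adj-row {g} {h} {h′} h~h′ = subst₂ R
      (sym (Fin.remQuot-combine g h)) (sym (Fin.remQuot-combine g h′)) (□⇒R (inj₁ (refl , h~h′)))

    adj-col : ∀ {g g′ h} → Adj G g g′ → Adj P (combine g h) (combine g′ h)
    adj-col {g} {g′} {h} g~g′ = subst₂ R
      (sym (Fin.remQuot-combine g h)) (sym (Fin.remQuot-combine g′ h)) (□⇒R (inj₂ (g~g′ , refl)))

    -- All three products contain the Cartesian edges, so neighbours within a row or column of `X`
    -- are neighbours of `X` in `P`. The matrix bound then applies with deviation `suc K * ∣ NX ∣`.
    onPairs-expands : ∀ {K} → Expands K G → Expands K H → Expands (3 * suc K) P
    onPairs-expands {K} expG expH X small = begin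
      ∣ X ∣                     ≡⟨ X.∣X∣≡∑# ⟩
      ∑[ i < m ] # (X.χ i)      ≤⟨ Majority.total≤3D X.χ (λ _ → _ ≤? _) A≤D B≤D
        (subst (λ x → 2 * x ≤ m * n) X.∣X∣≡∑# small) ⟩
      3 * (suc K * ∣ NX ∣)      ≡⟨ *-assoc 3 (suc K) ∣ NX ∣ ⟨
      3 * suc K * ∣ NX ∣        ∎
      where
      open ≤-Reasoning
      m = order G
      n = order H
      NX = N[ P ] X
      module X = Fibres m n X
      module NX = Fibres m n NX

      N-row : ∀ i → N[ H ] (X.row i) ⊆ NX.row i
      N-row i v∈N with v∉X , x , x∈X , x~v ← ∈-N⁻ H (X.row i) v∈N =
        NX.∈-row (∈-N⁺ P X (v∉X ∘ X.∈-row) (X.∈-row⁻ x∈X) (adj-row x~v))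

      N-col : ∀ j → N[ G ] (X.col j) ⊆ NX.col j
      N-col j v∈N with v∉X , x , x∈X , x~v ← ∈-N⁻ G (X.col j) v∈N =
        NX.∈-col (∈-N⁺ P X (v∉X ∘ X.∈-col) (X.∈-col⁻ x∈X) (adj-col x~v))

      -- One argument serves rows and columns: `twoSided` bounds each fibre, and the fibres of `NX`
      -- add up to `NX` without overlap.
      fibrewise : ∀ {k l} (F : Graph) (f g : Fin k → Subset (order F)) →
                  Expands K F → (∀ i → N[ F ] (f i) ⊆ g i) → l ≡ ∑[ i < k ] ∣ g i ∣ →
                  ∑[ i < k ] (∣ f i ∣ ⊓ ∣ ∁ (f i) ∣) ≤ suc K * l
      fibrewise {k} {l} F f g exp N⊆g l≡ = begin
        ∑[ i < k ] (∣ f i ∣ ⊓ ∣ ∁ (f i) ∣)  ≤⟨ sum-mono-≤ (λ i → ≤-trans (twoSided {K} F exp (f i))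
                                                (*-monoʳ-≤ (suc K) (p⊆q⇒∣p∣≤∣q∣ (N⊆g i)))) ⟩
        ∑[ i < k ] (suc K * ∣ g i ∣)        ≡⟨ *-distribˡ-sum (suc K) (λ i → ∣ g i ∣) ⟨
        suc K * ∑[ i < k ] ∣ g i ∣          ≡⟨ cong (suc K *_) l≡ ⟨
        suc K * l                           ∎

      A≤D = ≤-trans (≤-reflexive (sum-cong-≗ λ i → sym
          (cong₂ _⊓_ (∣tabulate∣≡# (X.χ i)) (∣∁tabulate∣≡# (X.χ i)))))
        (fibrewise H X.row NX.row expH N-row NX.∣X∣≡∑∣row∣)

      B≤D = ≤-trans (≤-reflexive (sum-cong-≗ λ j → sym
          (cong₂ _⊓_ (∣tabulate∣≡# (λ i → X.χ i j)) (∣∁tabulate∣≡# (λ i → X.χ i j)))))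
        (fibrewise G X.col NX.col expG N-col NX.∣X∣≡∑∣col∣)

  product-expands : ∀ ∗ G H {K} → Expands K G → Expands K H → Expands (3 * suc K) (G ⟨ ∗ ⟩ H)
  product-expands cartesian G H {K} =
    onPairs-expands G H (CartesianAdj G H) (adj? P) (adj-sym P) (adj-irrefl P) id {K}
    where P = G □ H
  product-expands strong G H {K} =
    onPairs-expands G H (StrongAdj G H) (adj? P) (adj-sym P) (adj-irrefl P) inj₁ {K}
    where P = G ⊠ H
  product-expands lexicographic G H {K} =
    onPairs-expands G H (LexicographicAdj G H) (adj? P) (adj-sym P) (adj-irrefl P)
      (λ { (inj₁ e) → inj₂ e ; (inj₂ (e , _)) → inj₁ e }) {K}
    where P = G ⊚ H

-- From expansion to a large bag in every tree-decomposition.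

module Treewidth where

  open import Data.Nat.Base using (ℕ; _+_; _*_; _⊔_; _≤_; _<_)
  open import Data.Nat.Properties
  open import Relation.Binary.Construct.Closure.ReflexiveTransitive as Star
    using (Star; ε; _◅_; _◅◅_)
  open Expansion

  -- The relation is arbitrary, so that paths in a tree and in a tree minus a node are treated
  -- alike.
  record SimplePath {n} (E : Rel (Fin n) 0ℓ) (a b : Fin n) : Set where
    field
      {length} : ℕ
      vertex   : Fin (suc length) → Fin n
      start    : vertex zero ≡ a
      end      : vertex (fromℕ length) ≡ b
      distinct : Injective _≡_ _≡_ vertex
      step     : ∀ i → E (vertex (inject₁ i)) (vertex (suc i))

  module _ {n} {E : Rel (Fin n) 0ℓ} where

    open SimplePath

    cons : ∀ {a b c} → E a c → (p : SimplePath E c b) → (∀ i → vertex p i ≢ a) → SimplePath E a b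
    cons {a} e p a∉p = record
      { vertex   = a Vector.∷ vertex p
      ; start    = refl
      ; end      = end p
      ; distinct = distinct′ _ _
      ; step     = λ where
          zero    → subst (E a) (sym (start p)) e
          (suc i) → step p i
      }
      where
      distinct′ : ∀ i j → (a Vector.∷ vertex p) i ≡ (a Vector.∷ vertex p) j → i ≡ j
      distinct′ zero    zero    _  = refl
      distinct′ zero    (suc j) eq = contradiction (sym eq) (a∉p j)
      distinct′ (suc i) zero    eq = contradiction eq (a∉p i)
      distinct′ (suc i) (suc j) eq = cong suc (distinct p eq)

    suffix : ∀ {a b} (p : SimplePath E a b) i → SimplePath E (vertex p i) b
    suffix p zero = record { SimplePath p ; start = refl }
    suffix p@record { length = suc _ } (suc i) = suffix tail i
      where
      tail : SimplePath E (vertex p (suc zero)) _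
      tail = record
        { vertex   = vertex p ∘ suc
        ; start    = refl
        ; end      = end p
        ; distinct = Fin.suc-injective ∘ distinct p
        ; step     = step p ∘ suc
        }

    -- Loops are erased from the far end: if the new first vertex already lies on the path, the path
    -- is cut back to that occurrence.
    simplify : ∀ {a b} → Star E a b → SimplePath E a b
    simplify {a} ε = record
      { length = 0 ; vertex = λ _ → a ; start = refl ; end = refl
      ; distinct = λ { {zero} {zero} _ → refl } ; step = λ () }
    simplify {a} (e ◅ w) with p ← simplify w with Fin.any? (λ i → vertex p i Fin.≟ a)
    ... | yes (i , refl) = suffix p i
    ... | no  a∉p        = cons e p λ i eq → a∉p (i , eq)

    firstVisit : ∀ {a b} → Star E a b → a ≢ b →
                 ∃[ c ] E c b × Star (λ x y → E x y × x ≢ b × y ≢ b) a c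
    firstVisit ε a≢b = contradiction refl a≢b
    firstVisit {b = b} (_◅_ {j = c} e w) a≢b with c Fin.≟ b
    ... | yes refl = _ , e , ε
    ... | no  c≢b  = Product.map₂ (Product.map₂ ((e , a≢b , c≢b) ◅_)) (firstVisit w c≢b)

  -- Separation by nodes and edges of a tree.

  module Tree {T : Graph} (isTree : IsTree T) where

    open IsTree isTree

    -- Walks in T − t.
    Avoid : V T → Rel (V T) 0ℓ
    Avoid t = Star λ a b → Adj T a b × a ≢ t × b ≢ t

    avoid-sym : ∀ {t a b} → Avoid t a b → Avoid t b a
    avoid-sym = Star.reverse λ (e , a≢t , b≢t) → adj-sym T e , b≢t , a≢t

    avoid-stuck : ∀ {t a} → Avoid t t a → a ≡ t
    avoid-stuck ε                   = refl
    avoid-stuck ((_ , t≢t , _) ◅ _) = contradiction refl t≢t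

    -- Two distinct neighbours of `s` joined by a path in `T − s` would close a cycle through `s`.
    branch-unique : ∀ {s r t} → Adj T s r → Adj T s t → Avoid s r t → r ≡ t
    branch-unique {s} {r} {t} s~r s~t w with simplify w
    ... | record { length = zero ; start = start ; end = end } = trans (sym start) end
    ... | p@record { length = suc k } = contradiction cycle acyclic
      where
      open SimplePath p
      -- The path has an edge, so each of its vertices is an end of a step and hence differs from
      -- `s`. Adding `s` gives at least three vertices.
      vertex≢s : ∀ i → vertex i ≢ s
      vertex≢s zero    = proj₁ (proj₂ (step zero))
      vertex≢s (suc i) = proj₂ (proj₂ (step i))

      q = cons s~r (record { SimplePath p ; step = proj₁ ∘ step }) vertex≢s

      cycle : Cycle T
      cycle = record
        { vertex   = SimplePath.vertex q
        ; distinct = SimplePath.distinct q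
        ; step     = SimplePath.step q
        ; closing  = subst (λ v → Adj T v s) (sym end) (adj-sym T s~t)
        }

    -- The first walk enters `s` from a neighbour `r` other than `t`. Going back from `r` to `u` and
    -- on to `t` avoids `s`, which puts two neighbours of `s` in one branch.
    edge-separates : ∀ {s t u} → Adj T s t → u ≢ s → Avoid t u s → ¬ Avoid s u t
    edge-separates s~t u≢s w w′ with r , (r~s , r≢t , _) , w″ ← firstVisit w u≢s =
      r≢t (branch-unique (adj-sym T r~s) s~t
        (avoid-sym (Star.map (λ ((e , _) , a≢s , b≢s) → e , a≢s , b≢s) w″) ◅◅ w′))

    avoid-or-reach : ∀ {s t a b} → a ≢ t → Avoid s a b → Avoid s a t ⊎ Avoid t a b
    avoid-or-reach a≢t ε = inj₂ ε
    avoid-or-reach {t = t} a≢t (_◅_ {j = c} e w) with c Fin.≟ t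
    ... | yes refl = inj₁ (e ◅ ε)
    ... | no  c≢t  = Sum.map (e ◅_) ((proj₁ e , a≢t , c≢t) ◅_) (avoid-or-reach c≢t w)

    neighbour-towards : ∀ {t x} → x ≢ t → ∃[ s ] Adj T s t × Avoid t x s
    neighbour-towards = firstVisit (Star.map proj₁ (InducesConnected.connected connected _ _))

    -- The node `u` lies in both branches. A walk from `u` through `y` to `z` that avoids `s` must
    -- also avoid `t`: reaching `t` would put `u` on both sides of the edge `st`.
    avoid-shrinks : ∀ {s t x y u} → Adj T s t → u ≢ s → u ≢ t →
      Avoid t x s → Avoid t x u → Avoid s y u → ∀ {z} → Avoid s y z → Avoid t x z
    avoid-shrinks s~t u≢s u≢t xs xu yu yz with avoid-or-reach u≢t (avoid-sym yu ◅◅ yz)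
    ... | inj₁ ut = contradiction ut (edge-separates s~t u≢s (avoid-sym xu ◅◅ xs))
    ... | inj₂ uz = xu ◅◅ uz

  large-intersect : ∀ {n} (X Y : Subset n) → ¬ 2 * ∣ X ∣ ≤ n → ¬ 2 * ∣ Y ∣ ≤ n →
                    ∃[ v ] v ∈ X × v ∈ Y
  large-intersect {n} X Y X-large Y-large with Fin.any? (λ v → (v ∈? X) ×-dec (v ∈? Y))
  ... | yes p = p
  ... | no ¬p = contradiction
    (begin-strict
      n + n                    <⟨ +-mono-< (≰⇒> X-large) (≰⇒> Y-large) ⟩
      2 * ∣ X ∣ + 2 * ∣ Y ∣    ≡⟨ *-distribˡ-+ 2 ∣ X ∣ ∣ Y ∣ ⟨
      2 * (∣ X ∣ + ∣ Y ∣)      ≤⟨ *-monoʳ-≤ 2 (+-monoʳ-≤ ∣ X ∣ (p⊆q⇒∣p∣≤∣q∣ Y⊆∁X)) ⟩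
      2 * (∣ X ∣ + ∣ ∁ X ∣)    ≡⟨ cong (2 *_) (∣p∣+∣∁p∣≡n X) ⟩
      2 * n                    ≡⟨ cong (n +_) (+-identityʳ n) ⟩
      n + n                    ∎)
    (<-irrefl refl)
    where
    open ≤-Reasoning
    Y⊆∁X : Y ⊆ ∁ X
    Y⊆∁X v∈Y = x∉p⇒x∈∁p λ v∈X → ¬p (_ , v∈X , v∈Y)

  module _ {n} (Q : Subset n → Set) (Q-⊥ : Q ⊥) (Q-∪ : ∀ {X Y} → Q X → Q Y → Q (X ∪ Y)) where

    -- Adding sets of size at most n/2 one by one, the first union of size at least n/4 has size
    -- at most n/2, unless the set just added is itself of size at least n/4.
    mediumUnion : ∀ {k} (W : Fin k → Subset n) → (∀ i → Q (W i)) → (∀ i → 2 * ∣ W i ∣ ≤ n) →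
      (∃[ U ] Q U × 2 * ∣ U ∣ ≤ n × n ≤ 4 * ∣ U ∣) ⊎
      (∃[ U ] Q U × 4 * ∣ U ∣ ≤ n × (∀ i → W i ⊆ U))
    mediumUnion {zero} W QW light =
      inj₂ (⊥ , Q-⊥ , subst (λ x → 4 * x ≤ n) (sym (∣⊥∣≡0 n)) z≤n , λ ())
    mediumUnion {suc k} W QW light
      with mediumUnion (W ∘ suc) (QW ∘ suc) (light ∘ suc)
    ... | inj₁ found = inj₁ found
    ... | inj₂ (U , QU , 4U≤n , W⊆U) with ≤-total n (4 * ∣ W zero ∣)
    ...   | inj₁ n≤4W = inj₁ (W zero , QW zero , light zero , n≤4W)
    ...   | inj₂ 4W≤n with ≤-total n (4 * ∣ W zero ∪ U ∣)
    ...     | inj₁ n≤4∪ = inj₁ (W zero ∪ U , Q-∪ (QW zero) QU , *-cancelˡ-≤ 2 2∪ , n≤4∪)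
      where
      open ≤-Reasoning
      2∪ : 2 * (2 * ∣ W zero ∪ U ∣) ≤ 2 * n
      2∪ = begin
        2 * (2 * ∣ W zero ∪ U ∣)       ≡⟨ *-assoc 2 2 ∣ W zero ∪ U ∣ ⟨
        4 * ∣ W zero ∪ U ∣             ≤⟨ *-monoʳ-≤ 4 (∣p∪q∣≤∣p∣+∣q∣ (W zero) U) ⟩
        4 * (∣ W zero ∣ + ∣ U ∣)       ≡⟨ *-distribˡ-+ 4 ∣ W zero ∣ ∣ U ∣ ⟩
        4 * ∣ W zero ∣ + 4 * ∣ U ∣     ≤⟨ +-mono-≤ 4W≤n 4U≤n ⟩
        n + n                          ≡⟨ cong (n +_) (+-identityʳ n) ⟨
        2 * n                          ∎
    ...     | inj₂ 4∪≤n = inj₂ (W zero ∪ U , Q-∪ (QW zero) QU , 4∪≤n , λ where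
      zero    → p⊆p∪q U
      (suc i) → q⊆p∪q (W zero) U ∘ W⊆U i)

  -- Balanced bags and large bags.

  module Separator {G : Graph} (D : TreeDecomposition G) where

    open TreeDecomposition D
    open Tree isTree
    private
      module Subtree v = InducesConnected (vertexSubtree v)

    -- This says that the neighbourhood of `X` lies in the bag at `t`, in a form that passes
    -- directly to unions.
    Closed : V T → Subset (order G) → Set
    Closed t X = ∀ {v w} → v ∈ X → Adj G v w → w ∈ X ⊎ w ∈ β t

    closed-∪ : ∀ {t X Y} → Closed t X → Closed t Y → Closed t (X ∪ Y)
    closed-∪ {t} {X} {Y} cX cY v∈ v~w with x∈p∪q⁻ X Y v∈
    ... | inj₁ v∈X = Sum.map₁ (λ w∈X → x∈p∪q⁺ (inj₁ w∈X)) (cX v∈X v~w)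
    ... | inj₂ v∈Y = Sum.map₁ (λ w∈Y → x∈p∪q⁺ (inj₂ w∈Y)) (cY v∈Y v~w)

    N⊆β : ∀ {t X} → Closed t X → N[ G ] X ⊆ β t
    N⊆β {t} {X} cX v∈N with v∉X , x , x∈X , x~v ← ∈-N⁻ G X v∈N with cX x∈X x~v
    ... | inj₁ v∈X = contradiction v∈X v∉X
    ... | inj₂ v∈β = v∈β

    subtree-avoids : ∀ {t v a b} → v ∉ β t → v ∈ β a → v ∈ β b → Avoid t a b
    subtree-avoids {t} {v} v∉βt v∈βa v∈βb = Star.map
      (λ (e , v∈x , v∈y) → e , (λ { refl → v∉βt v∈x }) , (λ { refl → v∉βt v∈y }))
      (Subtree.connected v v∈βa v∈βb)

    module _ (avoid? : ∀ t x y → Dec (Avoid t x y)) where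

      InW : V T → V T → V G → Set
      InW t x v = v ∉ β t × ∃[ u ] v ∈ β u × Avoid t x u

      inW? : ∀ t x → Decidable (InW t x)
      inW? t x v = ¬? (v ∈? β t) ×-dec Fin.any? λ u → (v ∈? β u) ×-dec avoid? t x u

      -- The vertices of G − β(t) whose subtrees lie in the component of T − t containing x.
      W : V T → V T → Subset (order G)
      W t x = subset (inW? t x)

      ∁β⊆W : ∀ {t v} → v ∉ β t → ∃[ x ] v ∈ W t x
      ∁β⊆W {t} {v} v∉βt with x , v∈βx ← Subtree.nonempty v =
        x , ∈-subset⁺ (inW? t x) (v∉βt , x , v∈βx , ε)

      -- A bag `β s` covering the edge contains `v`, whose subtree misses `t`; hence `s` lies in the
      -- component of `x`, and `w` with it.
      W-closed : ∀ t x → Closed t (W t x)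
      W-closed t x {v} {w} v∈W v~w with w ∈? β t
      ... | yes w∈βt = inj₂ w∈βt
      ... | no  w∉βt with v∉βt , u , v∈βu , xu ← ∈-subset⁻ (inW? t x) v∈W
                        | s , v∈βs , w∈βs ← edgeCovered v~w =
        inj₁ (∈-subset⁺ (inW? t x) (w∉βt , s , w∈βs , xu ◅◅ subtree-avoids v∉βt v∈βu v∈βs))

      Light : V T → V T → Set
      Light t x = 2 * ∣ W t x ∣ ≤ order G

      branch : V T → V T → Subset (order T)
      branch t x = subset (avoid? t x)

      -- Following heavy branches, the branch pointed at shrinks at every step.
      descend : (∀ t → ∃[ x ] ¬ Light t x) → ∀ {t x} → ¬ Light t x → ¬ Acc _<_ ∣ branch t x ∣
      descend heavy {t} {x} tx (acc rec) with x Fin.≟ t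
      -- No walk in `T − t` leaves `t`, so `W t t` is empty and cannot be heavy.
      ... | yes refl = tx (subst (λ k → 2 * k ≤ order G) (sym W≡0) z≤n)
        where
        W-empty : ∀ {v} → v ∉ W t t
        W-empty v∈W with v∉βt , u , v∈βu , tu ← ∈-subset⁻ (inW? t t) v∈W
          with refl ← avoid-stuck tu = v∉βt v∈βu

        W≡0 : ∣ W t t ∣ ≡ 0
        W≡0 = trans (cong ∣_∣ (Empty-unique λ (_ , v∈W) → W-empty v∈W)) (∣⊥∣≡0 (order G))
      ... | no x≢t with s , s~t , xs ← neighbour-towards x≢t
                      | y , sy ← heavy (proj₁ (neighbour-towards x≢t))
        -- Two sets of more than half the vertices share some `v`; its subtree misses both `s` and
        -- `t` and links the two branches.
        with v , v∈tx , v∈sy ← large-intersect (W t x) (W s y) tx sy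
        with v∉βt , u′ , v∈βu′ , xu′ ← ∈-subset⁻ (inW? t x) v∈tx
           | v∉βs , u , v∈βu , yu ← ∈-subset⁻ (inW? s y) v∈sy =
        -- The inclusion is strict because `s` lies in the old branch but not in the new one.
        descend heavy sy (rec (p⊂q⇒∣p∣<∣q∣ (shrinks , s , ∈-subset⁺ (avoid? t x) xs , s∉)))
        where
        u≢s : u ≢ s
        u≢s refl = v∉βs v∈βu

        u≢t : u ≢ t
        u≢t refl = v∉βt v∈βu

        shrinks : branch s y ⊆ branch t x
        shrinks z∈ = ∈-subset⁺ (avoid? t x) (avoid-shrinks s~t u≢s u≢t xs
          (xu′ ◅◅ subtree-avoids v∉βt v∈βu′ v∈βu) yu (∈-subset⁻ (avoid? s y) z∈))

        s∉ : s ∉ branch s y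
        s∉ s∈ = u≢s (avoid-stuck (avoid-sym (∈-subset⁻ (avoid? s y) s∈) ◅◅ yu))

      -- Otherwise every node has a heavy branch, and the descent from any node would never end.
      balanced : ∃[ t ] ∀ x → Light t x
      balanced with Fin.any? (λ t → Fin.all? λ x → 2 * ∣ W t x ∣ ≤? order G)
      ... | yes found = found
      ... | no  none  = contradiction (<-wellFounded _) (descend heavy (proj₂ (heavy root)))
        where
        root = proj₁ (InducesConnected.nonempty (IsTree.connected isTree))

        heavy : ∀ t → ∃[ x ] ¬ Light t x
        heavy t = Fin.¬∀⟶∃¬ (order T) (Light t) (λ x → 2 * ∣ W t x ∣ ≤? order G)
          λ light → none (t , light)

      large-bag : ∀ {L} → 1 ≤ L → Expands L G → ∃[ t ] order G ≤ 4 * L * ∣ β t ∣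
      large-bag {L} 1≤L exp with t , light ← balanced = t , case
        where
        open ≤-Reasoning
        n = order G
        case : order G ≤ 4 * L * ∣ β t ∣
        case with mediumUnion (Closed t) (λ v∈⊥ → contradiction v∈⊥ ∉⊥)
          (λ {X} {Y} → closed-∪ {t} {X} {Y}) (W t) (W-closed t) light
        ... | inj₁ (U , cU , 2U≤n , n≤4U) = begin
          n                          ≤⟨ n≤4U ⟩
          4 * ∣ U ∣                  ≤⟨ *-monoʳ-≤ 4 (exp U 2U≤n) ⟩
          4 * (L * ∣ N[ G ] U ∣)     ≤⟨ *-monoʳ-≤ 4 (*-monoʳ-≤ L (p⊆q⇒∣p∣≤∣q∣ (N⊆β {t} {U} cU))) ⟩
          4 * (L * ∣ β t ∣)          ≡⟨ *-assoc 4 L ∣ β t ∣ ⟨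
          4 * L * ∣ β t ∣            ∎
        -- All sets `W t x` together have at most `n/4` vertices and cover the complement of the
        -- bag, so the bag itself is large.
        ... | inj₂ (U , _ , 4U≤n , W⊆U) = begin
          n                          ≤⟨ +-cancelˡ-≤ n _ _ (begin
            n + n                        ≤⟨ m≤m+n (n + n) (n + (n + 0)) ⟩
            n + n + (n + (n + 0))        ≡⟨ +-assoc n n (n + (n + 0)) ⟩
            4 * n                        ≡⟨ cong (4 *_) (∣p∣+∣∁p∣≡n (β t)) ⟨
            4 * (∣ β t ∣ + ∣ ∁ (β t) ∣)  ≤⟨ *-monoʳ-≤ 4 (+-monoʳ-≤ ∣ β t ∣ (p⊆q⇒∣p∣≤∣q∣ ∁β⊆U)) ⟩
            4 * (∣ β t ∣ + ∣ U ∣)        ≡⟨ *-distribˡ-+ 4 ∣ β t ∣ ∣ U ∣ ⟩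
            4 * ∣ β t ∣ + 4 * ∣ U ∣      ≤⟨ +-monoʳ-≤ (4 * ∣ β t ∣) 4U≤n ⟩
            4 * ∣ β t ∣ + n              ≡⟨ +-comm (4 * ∣ β t ∣) n ⟩
            n + 4 * ∣ β t ∣              ∎) ⟩
          4 * ∣ β t ∣                ≤⟨ *-monoˡ-≤ ∣ β t ∣ (*-monoʳ-≤ 4 1≤L) ⟩
          4 * L * ∣ β t ∣            ∎
          where
          ∁β⊆U : ∁ (β t) ⊆ U
          ∁β⊆U v∈∁β with x , v∈W ← ∁β⊆W (x∈∁p⇒x∉p v∈∁β) = W⊆U x v∈W

    -- Excluded middle holds under double negation for each triple, and double negation commutes
    -- with quantifiers over finite sets.
    ¬¬-avoid? : ¬ ¬ (∀ t x y → Dec (Avoid t x y))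
    ¬¬-avoid? = seq λ t → seq λ x → seq λ y → ¬¬-excluded-middle
      where
      seq : ∀ {n} {P : Fin n → Set} → (∀ i → ¬ ¬ P i) → ¬ ¬ (∀ i → P i)
      seq = Fin.sequence (RawMonad.rawApplicative ¬¬-Monad)

    -- The width is `maxBag ⊖ 1` by definition.
    maxBag : ℕ
    maxBag = Vector.foldr _⊔_ 0 λ t → ∣ β t ∣

    ∣β∣≤maxBag : ∀ t → ∣ β t ∣ ≤ maxBag
    ∣β∣≤maxBag = lookup≤max λ t → ∣ β t ∣
      where
      lookup≤max : ∀ {k} (f : Fin k → ℕ) i → f i ≤ Vector.foldr _⊔_ 0 f
      lookup≤max f zero    = m≤m⊔n (f zero) _
      lookup≤max f (suc i) = ≤-trans (lookup≤max (f ∘ suc) i) (m≤n⊔m (f zero) _)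

    -- The conclusion is decidable, hence stable, so reachability in `T − t` may be treated as
    -- decidable while proving it.
    order≤maxBag : ∀ {L} → 1 ≤ L → Expands L G → order G ≤ 4 * L * maxBag
    order≤maxBag {L} 1≤L exp = decidable-stable (order G ≤? 4 * L * maxBag) λ n≰ →
      ¬¬-avoid? λ avoid? → let t , n≤ = large-bag avoid? {L} 1≤L exp in
        n≰ (≤-trans n≤ (*-monoʳ-≤ (4 * L) (∣β∣≤maxBag t)))

    -- Makes the width at least one, which later absorbs the `− 1` in its definition.
    edge⇒2≤maxBag : ∀ {u v} → Adj G u v → 2 ≤ maxBag
    edge⇒2≤maxBag {u} {v} u~v with t , u∈βt , v∈βt ← edgeCovered u~v =
      ≤-trans (subst (_< ∣ β t ∣) (∣⁅x⁆∣≡1 u) (p⊂q⇒∣p∣<∣q∣ ⁅u⁆⊂βt)) (∣β∣≤maxBag t)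
      where
      ⁅u⁆⊂βt : ⁅ u ⁆ ⊂ β t
      ⁅u⁆⊂βt = (λ x∈ → subst (_∈ β t) (sym (x∈⁅y⁆⇒x≡y u x∈)) u∈βt) , v , v∈βt ,
        λ v∈ → adj-irrefl G (sym (x∈⁅y⁆⇒x≡y u v∈)) u~v

open Expansion
open Treewidth
open import Data.Integer.Base as ℤ using (+_)
open import Data.Rational.Base
  using (ℚ; mkℚ; _/_; *<*; *≤*; toℚᵘ; _<_; _≤_; _*_; _-_; 0ℚ; 1ℚ)

-- Passing between rational and natural-number bounds.

/-≤⁺ : ∀ a c {b d} .{{_ : NonZero b}} .{{_ : NonZero d}} →
       a ℕ.* d ℕ.≤ c ℕ.* b → + a / b ≤ + c / d
/-≤⁺ a c {suc b} {suc d} le = ℚ.toℚᵘ-cancel-≤ (begin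
  toℚᵘ (+ a / suc b)  ≃⟨ ℚ.toℚᵘ-fromℚᵘ (ℚᵘ.mkℚᵘ (+ a) b) ⟩
  ℚᵘ.mkℚᵘ (+ a) b     ≤⟨ ℚᵘ.*≤* (subst₂ ℤ._≤_ (ℤ.pos-* a (suc d)) (ℤ.pos-* c (suc b)) (ℤ.+≤+ le)) ⟩
  ℚᵘ.mkℚᵘ (+ c) d     ≃⟨ ℚ.toℚᵘ-fromℚᵘ (ℚᵘ.mkℚᵘ (+ c) d) ⟨
  toℚᵘ (+ c / suc d)  ∎)
  where open ℚᵘ.≤-Reasoning

/-≤⁻ : ∀ a c {b d} .{{_ : NonZero b}} .{{_ : NonZero d}} →
       + a / b ≤ + c / d → a ℕ.* d ℕ.≤ c ℕ.* b
/-≤⁻ a c {suc b} {suc d} le = ℤ.drop‿+≤+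
  (subst₂ ℤ._≤_ (sym (ℤ.pos-* a (suc d))) (sym (ℤ.pos-* c (suc b))) (ℚᵘ.drop-*≤* (begin
    ℚᵘ.mkℚᵘ (+ a) b     ≃⟨ ℚ.toℚᵘ-fromℚᵘ (ℚᵘ.mkℚᵘ (+ a) b) ⟨
    toℚᵘ (+ a / suc b)  ≤⟨ ℚ.toℚᵘ-mono-≤ le ⟩
    toℚᵘ (+ c / suc d)  ≃⟨ ℚ.toℚᵘ-fromℚᵘ (ℚᵘ.mkℚᵘ (+ c) d) ⟩
    ℚᵘ.mkℚᵘ (+ c) d     ∎)))
  where open ℚᵘ.≤-Reasoning

-- A positive fraction is at least the reciprocal of its own denominator.
1/≤positive : ∀ {ε} → 0ℚ < ε → ∃[ k ] + 1 / suc k ≤ ε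
1/≤positive {mkℚ (+ zero)     _ _} (*<* (ℤ.+<+ ()))
1/≤positive {ε@(mkℚ (+ suc a) d _)} _ = d , subst (+ 1 / suc d ≤_) (ℚ.↥p/↧p≡p ε)
  (/-≤⁺ 1 (suc a) (ℕ.*-monoˡ-≤ (suc d) (s≤s (z≤n {a}))))
1/≤positive {mkℚ ℤ.-[1+ _ ] _ _} (*<* ())

module _ (G : Graph) {ε : ℚ} where

  φ≥⇒Expands : ∀ k → + 1 / suc k ≤ ε → φ[ G ]≥ ε → Expands (suc k) G
  φ≥⇒Expands k 1/K≤ε (q , isφ , ε≤q) X small with ∣ X ∣ in eq
  ... | zero  = z≤n
  ... | suc x = subst₂ ℕ._≤_ (trans (ℕ.*-identityˡ ∣ X ∣) eq) (ℕ.*-comm ∣ N[ G ] X ∣ (suc k))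
    (/-≤⁻ 1 ∣ N[ G ] X ∣ (ℚ.≤-trans 1/K≤ε (ℚ.≤-trans ε≤q
      (IsVertexExpansion.minimal isφ X (subst (λ y → 2 ℕ.* y ℕ.≤ order G) (sym eq) small)))))
    where
    instance
      nonZero : NonZero ∣ X ∣
      nonZero = subst NonZero (sym eq) _

  -- A set attaining the minimum is non-empty and has at most half of the vertices.
  φ≥⇒2≤order : φ[ G ]≥ ε → 2 ℕ.≤ order G
  φ≥⇒2≤order (_ , isφ , _) with X , nz , 2X≤n , _ ← IsVertexExpansion.attained isφ =
    ℕ.≤-trans (ℕ.*-monoʳ-≤ 2 (ℕ.>-nonZero⁻¹ ∣ X ∣ {{nz}})) 2X≤n

subsets : ∀ n → List (Subset n)
subsets zero    = List.[ [] ]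
subsets (suc n) = List.map (inside ∷_) (subsets n) List.++ List.map (outside ∷_) (subsets n)

∈-subsets : ∀ {n} (X : Subset n) → X ∈ₗ subsets n
∈-subsets []            = here refl
∈-subsets (inside ∷ X)  = ∈-++⁺ˡ (∈-map⁺ (inside ∷_) (∈-subsets X))
∈-subsets (outside ∷ X) =
  ∈-++⁺ʳ (List.map (inside ∷_) (subsets _)) (∈-map⁺ (outside ∷_) (∈-subsets X))

-- Exhaustive search; it supplies the attained minimum that `φ[_]≥_` asks for.
minimalSubset : ∀ {n} (f : Subset n → ℚ) {P : Subset n → Set} → Decidable P → ∃ P →
                ∃[ X ] P X × (∀ Y → P Y → f X ≤ f Y)
minimalSubset {n} f P? (X₀ , p₀) =
  argmin f X₀ candidates ,
  argmin-all f p₀ (all-filter P? (subsets n)) ,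
  λ Y q → All.lookup (f[argmin]≤f[xs] X₀ candidates) (∈-filter⁺ P? (∈-subsets Y) q)
  where
  open Data.List.Extrema (DecTotalOrder.totalOrder ℚ.≤-decTotalOrder)
  candidates = List.filter P? (subsets n)

module _ (G : Graph) where

  -- The value 0ℚ at the empty set is never used.
  ratio : Subset (order G) → ℚ
  ratio X with ∣ X ∣
  ... | zero  = 0ℚ
  ... | suc x = + ∣ N[ G ] X ∣ / suc x

  ratio≡expansionRatio : ∀ X .{{nz : NonZero ∣ X ∣}} → ratio X ≡ expansionRatio G X
  ratio≡expansionRatio X with suc _ ← ∣ X ∣ = refl

  Expands⇒φ≥ : ∀ k → 2 ℕ.≤ order G → Expands (suc k) G → φ[ G ]≥ (+ 1 / suc k)
  Expands⇒φ≥ k 2≤n exp with minimalSubset ratio {Admissible} admissible? (singleton {order G} 2≤n)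
    where
    Admissible : Subset (order G) → Set
    Admissible X = NonZero ∣ X ∣ × 2 ℕ.* ∣ X ∣ ℕ.≤ order G

    admissible? : Decidable Admissible
    admissible? X = ℕ.nonZero? ∣ X ∣ ×-dec (2 ℕ.* ∣ X ∣ ℕ.≤? order G)

    -- With two or more vertices a singleton is admissible, so the search has a starting point.
    singleton : ∀ {n} → 2 ℕ.≤ n → Σ (Subset n) λ X → NonZero ∣ X ∣ × 2 ℕ.* ∣ X ∣ ℕ.≤ n
    singleton {suc n} 2≤n = ⁅ zero ⁆ , subst NonZero (sym (∣⁅x⁆∣≡1 {suc n} zero)) _ ,
      subst (λ x → 2 ℕ.* x ℕ.≤ suc n) (sym (∣⁅x⁆∣≡1 {suc n} zero)) 2≤n
  ... | X , (nz , small) , min = expansionRatio G X {{nz}} ,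
    record
      { attained = X , nz , small , refl
      ; minimal  = λ Y {{nz′}} small′ →
          subst₂ _≤_ (ratio≡expansionRatio X {{nz}}) (ratio≡expansionRatio Y {{nz′}})
            -- The irrelevant proof that `Y` is non-empty is turned into a relevant one, as
            -- `Admissible` requires.
            (min Y (ℕ.≢-nonZero (ℕ.≢-nonZero⁻¹ ∣ Y ∣) , small′))
      } ,
    /-≤⁺ 1 ∣ N[ G ] X ∣ {{_}} {{nz}}
      (subst₂ ℕ._≤_ (sym (ℕ.*-identityˡ ∣ X ∣)) (ℕ.*-comm (suc k) ∣ N[ G ] X ∣) (exp X small))

-- A singleton without neighbours would violate expansion.
expands⇒neighbour : ∀ {K} G → 2 ℕ.≤ order G → Expands K G → ∀ v → ∃ (Adj G v)
expands⇒neighbour {K} G 2≤n exp v with nonempty? (N[ G ] ⁅ v ⁆)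
... | yes (u , u∈N) with _ , x , x∈⁅v⁆ , x~u ← ∈-N⁻ G ⁅ v ⁆ u∈N
  with refl ← x∈⁅y⁆⇒x≡y v x∈⁅v⁆ = u , x~u
... | no  empty = contradiction (begin
  1                        ≡⟨ ∣⁅x⁆∣≡1 v ⟨
  ∣ ⁅ v ⁆ ∣                ≤⟨ exp ⁅ v ⁆ (subst (λ k → 2 ℕ.* k ℕ.≤ order G) (sym (∣⁅x⁆∣≡1 v)) 2≤n) ⟩
  K ℕ.* ∣ N[ G ] ⁅ v ⁆ ∣   ≡⟨ cong (λ X → K ℕ.* ∣ X ∣) (Empty-unique empty) ⟩
  K ℕ.* ∣ ⊥ {order G} ∣    ≡⟨ cong (K ℕ.*_) (∣⊥∣≡0 (order G)) ⟩
  K ℕ.* 0                  ≡⟨ ℕ.*-zeroʳ K ⟩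
  0                        ∎) λ ()
  where open ℕ.≤-Reasoning

1/d*n≤a : ∀ d n a → n ℕ.≤ suc d ℕ.* a → + 1 / suc d * (+ n / 1) ≤ + a / 1
1/d*n≤a d n a n≤da = ℚ.toℚᵘ-cancel-≤ (begin
  toℚᵘ (+ 1 / suc d * (+ n / 1))                ≃⟨ ℚ.toℚᵘ-homo-* (+ 1 / suc d) (+ n / 1) ⟩
  toℚᵘ (+ 1 / suc d) ℚᵘ.* toℚᵘ (+ n / 1)        ≃⟨ ℚᵘ.*-cong
    (ℚ.toℚᵘ-fromℚᵘ (ℚᵘ.mkℚᵘ (+ 1) d)) (ℚ.toℚᵘ-fromℚᵘ (ℚᵘ.mkℚᵘ (+ n) 0)) ⟩
  ℚᵘ.mkℚᵘ (+ 1) d ℚᵘ.* ℚᵘ.mkℚᵘ (+ n) 0          ≤⟨ ℚᵘ.*≤* n*1≤ ⟩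
  ℚᵘ.mkℚᵘ (+ a) 0                               ≃⟨ ℚ.toℚᵘ-fromℚᵘ (ℚᵘ.mkℚᵘ (+ a) 0) ⟨
  toℚᵘ (+ a / 1)                                ∎)
  where
  open ℚᵘ.≤-Reasoning
  n*1≤ : (+ 1 ℤ.* + n) ℤ.* + 1 ℤ.≤ + a ℤ.* + (suc d ℕ.* 1)
  n*1≤ = subst₂ ℤ._≤_ (sym (trans (ℤ.*-identityʳ (+ 1 ℤ.* + n)) (ℤ.*-identityˡ (+ n))))
    (trans (cong +_ (trans (ℕ.*-comm (suc d) a) (cong (a ℕ.*_) (sym (ℕ.*-identityʳ (suc d))))))
           (ℤ.pos-* a (suc d ℕ.* 1)))
    (ℤ.+≤+ n≤da)

-- The largest bag has at least `n/(4L)` vertices. Its size is at most twice the width, since the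
-- width is at least one; this turns `4L` into `8L`.
expands⇒tw≥ : ∀ {L} G → 1 ℕ.≤ L → 2 ℕ.≤ order G → Expands L G → ∀ d → 8 ℕ.* L ℕ.≤ suc d →
              tw[ G ]≥ (+ 1 / suc d * ∣V G ∣)
expands⇒tw≥ {L} G 1≤L 2≤n exp d 8L≤d D =
  bound maxBag (edge⇒2≤maxBag (proj₂ edge)) (order≤maxBag {L} 1≤L exp)
  where
  open Separator D
  open ℕ.≤-Reasoning

  edge = expands⇒neighbour {L} G 2≤n exp (fromℕ< 2≤n)

  bound : ∀ b → 2 ℕ.≤ b → order G ℕ.≤ 4 ℕ.* L ℕ.* b → + 1 / suc d * ∣V G ∣ ≤ (b ℤ.⊖ 1) / 1
  bound (suc b) (s≤s 1≤b) n≤ = 1/d*n≤a d (order G) b (begin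
    order G                     ≤⟨ n≤ ⟩
    4 ℕ.* L ℕ.* (1 ℕ.+ b)       ≤⟨ ℕ.*-monoʳ-≤ (4 ℕ.* L) (ℕ.+-monoˡ-≤ b 1≤b) ⟩
    4 ℕ.* L ℕ.* (b ℕ.+ b)       ≡⟨ regroup L b ⟩
    8 ℕ.* L ℕ.* b               ≤⟨ ℕ.*-monoˡ-≤ b 8L≤d ⟩
    suc d ℕ.* b                 ∎)
    where
    regroup : ∀ L b → 4 ℕ.* L ℕ.* (b ℕ.+ b) ≡ 8 ℕ.* L ℕ.* b
    regroup = solve-∀

-- The product as its own subgraph.

p-1≤p : ∀ p → p - 1ℚ ≤ p
p-1≤p p = ℚ.≤-trans (ℚ.+-monoʳ-≤ p (*≤* ℤ.-≤+)) (ℚ.≤-reflexive (ℚ.+-identityʳ p))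

order-product : ∀ ∗ G H → order (G ⟨ ∗ ⟩ H) ≡ order G ℕ.* order H
order-product cartesian     G H = refl
order-product strong        G H = refl
order-product lexicographic G H = refl

⊑-refl : ∀ G → G ⊑ G
⊑-refl G = record { embed = id ; injective = id ; preserves = id }

theorem16 : ∀ {ℓ₁ ℓ₂} (∗ : Product) (𝒢 : GraphClass ℓ₁) (ℋ : GraphClass ℓ₂) →
    PositiveVertexExpansion 𝒢 → PositiveVertexExpansion ℋ →
    ∃[ c ] (0ℚ < c × (∀ P → ProductClass ∗ 𝒢 ℋ P →
    ∃[ S ] (S ⊑ P × tw[ S ]≥ (c * ∣V P ∣) × (c * ∣V P ∣ - 1ℚ) ≤ ∣V S ∣ × φ[ S ]≥ c)))
theorem16 ∗ 𝒢 ℋ (ε , ε>0 , φ𝒢≥ε) (δ , δ>0 , φℋ≥δ)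
  with k , 1/k≤ε ← 1/≤positive ε>0
     | l , 1/l≤δ ← 1/≤positive δ>0 =
  + 1 / suc d , ℚ.positive⁻¹ (+ 1 / suc d) {{ℚ.normalize-pos 1 (suc d)}} , subgraph
  where
  -- `K` exceeds both `k` and `l`, so both factors expand with constant `K` and the product with
  -- `L`. Here `suc d` is `8 * L`, the constant needed for the treewidth.
  K = suc (k ℕ.+ l)
  L = 3 ℕ.* suc K
  d = ℕ.pred (8 ℕ.* L)

  subgraph : ∀ P → ProductClass ∗ 𝒢 ℋ P → _
  subgraph P (G , H , G∈𝒢 , H∈ℋ , refl) =
    P , ⊑-refl P ,
    expands⇒tw≥ {L} P (s≤s z≤n) 2≤n expP d ℕ.≤-refl ,
    -- Since the subgraph is `P` itself and the constant is at most one, the size bound is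
    -- immediate.
    ℚ.≤-trans (p-1≤p (+ 1 / suc d * ∣V P ∣))
      (1/d*n≤a d (order P) (order P) (ℕ.m≤n*m (order P) (suc d))) ,
    Expands⇒φ≥ P d 2≤n (expands-mono {L} {suc d} P (ℕ.m≤n*m L 8) expP)
    where
    φG = φ𝒢≥ε G G∈𝒢
    φH = φℋ≥δ H H∈ℋ

    2≤n : 2 ℕ.≤ order P
    2≤n = subst (2 ℕ.≤_) (sym (order-product ∗ G H))
      (ℕ.≤-trans (s≤s (s≤s z≤n)) (ℕ.*-mono-≤ (φ≥⇒2≤order G φG) (φ≥⇒2≤order H φH)))

    expP : Expands L P
    expP = product-expands ∗ G H {K}
      (expands-mono {suc k} {K} G (s≤s (ℕ.m≤m+n k l)) (φ≥⇒Expands G k 1/k≤ε φG))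
      (expands-mono {suc l} {K} H (s≤s (ℕ.m≤n+m l k)) (φ≥⇒Expands H l 1/l≤δ φH))
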